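{- Let $C\subseteq K$ be a Cartesian effect category with semi-pure products $\ltimes,\rtimes$. For all objects $X,Y$ put $A(X,Y)=K(X,Y)$; let $\mathtt{arr}:C(X,Y)\to A(X,Y)$ be the inclusion $C(X,Y)\subseteq K(X,Y)$; for $f\in A(X,Y)$ and $g\in A(Y,Z)$ let $f>\!\!>\!\!>g=g\circ f\in A(X,Z)$; and for $f\in A(X,Y)$ and an object $Z$ let $\mathtt{first}\,f=f\rtimes\mathrm{id}_Z\in A(X\times Z,Y\times Z)$. Then $A$ with these operations is an Arrow on $C$.
   Context: **Cartesian effect categories.** A subcategory $C$ of a category $K$ is wide if it has the same objects as $K$; morphisms of $K$ lying in $C$ are called pure. A pure terminal object is an object $1$ that is terminal in $C$, and $\langle\,\rangle_X:X\to 1$ denotes the unique pure morphism. The effect of $f:X\to Y$ in $K$ is $\mathcal{E}(f)=\langle\,\rangle_Y\circ f$; for $f:X\to Y$ and $f':X\to Y'$, write $f\approx f'$ iff $\mathcal{E}(f)=\mathcal{E}(f')$. A consistency relation $\lhd$ is a relation between parallel morphisms of $K$, the second one being pure, such that (i) $v\lhd v$ for every pure $v$; (ii) for all $f:X\to Y$, $g:Y\to Z$ in $K$ and all pure $u:Y\to Y'$, $v:X\to Y'$, $w:Y'\to Z$, if $u\circ f\lhd v$ and $g\lhd w\circ u$ then $g\circ f\lhd w\circ v$. Write $f\lhd\rhd f'$ iff there is a pure $v$ with $f\lhd v$ and $f'\lhd v$. An effect category consists of a category $K$, a wide subcategory $C$, a pure terminal object $1$ and a consistency relation $\lhd$ satisfying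 complementarity: for parallel $f,f'$, if $f\approx f'$ and $f\lhd\rhd f'$ then $f=f'$. A Cartesian effect category is an effect category in which $C$ has chosen finite products (terminal object $1$, binary products $\times$), together with two graph homomorphisms $\ltimes:C\times K\to K$ and $\rtimes:K\times C\to K$ (the semi-pure products), sending $(X_1,X_2)$ to $X_1\times X_2$ on objects, both extending $\times$ on pairs of pure morphisms, and such that, with projections $p_i:X_1\times X_2\to X_i$ and $q_i:Y_1\times Y_2\to Y_i$: for all pure $v_1:X_1\to Y_1$ and all $f_2:X_2\to Y_2$ in $K$, $v_1\ltimes f_2:X_1\times X_2\to Y_1\times Y_2$ is the unique morphism of $K$ with $q_1\circ(v_1\ltimes f_2)\lhd v_1\circ p_1$ and $q_2\circ(v_1\ltimes f_2)=f_2\circ p_2$; and for all $f_1:X_1\to Y_1$ in $K$ and all pure $v_2:X_2\to Y_2$, $f_1\rtimes v_2$ is the unique morphism of $K$ with $q_1\circ(f_1\rtimes v_2)=f_1\circ p_1$ and $q_2\circ(f_1\rtimes v_2)\lhd v_2\circ p_2$. **Arrows.** For a Cartesian category $C$ (chosen finite products), an Arrow $A$ on $C$ associates to all objects $X,Y$ of $C$ a set $A(X,Y)$, together with operations $\mathtt{arr}:C(X,Y)\to A(X,Y)$, $(>\!\!>\!\!>):A(X,Y)\to A(Y,Z)\to A(X,Z)$ and $\mathtt{first}:A(X,Y)\to A(X\times Z,Y\times Z)$ (for all objects $X,Y,Z$) satisfying, whenever the expressions make sense ($f,g,h$ in $A$; $v,w$ in $C$): (1) $\mathtt{arr}\,\mathrm{id}>\!\!>\!\!>f=f$;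 (2) $f>\!\!>\!\!>\mathtt{arr}\,\mathrm{id}=f$; (3) $(f>\!\!>\!\!>g)>\!\!>\!\!>h=f>\!\!>\!\!>(g>\!\!>\!\!>h)$; (4) $\mathtt{arr}(w\circ v)=\mathtt{arr}\,v>\!\!>\!\!>\mathtt{arr}\,w$; (5) $\mathtt{first}(\mathtt{arr}\,v)=\mathtt{arr}(v\times\mathrm{id})$; (6) $\mathtt{first}(f>\!\!>\!\!>g)=\mathtt{first}\,f>\!\!>\!\!>\mathtt{first}\,g$; (7) $\mathtt{first}\,f>\!\!>\!\!>\mathtt{arr}(\mathrm{id}\times v)=\mathtt{arr}(\mathrm{id}\times v)>\!\!>\!\!>\mathtt{first}\,f$; (8) $\mathtt{first}\,f>\!\!>\!\!>\mathtt{arr}\,\mathtt{fst}=\mathtt{arr}\,\mathtt{fst}>\!\!>\!\!>f$; (9) $\mathtt{first}(\mathtt{first}\,f)>\!\!>\!\!>\mathtt{arr}\,\mathtt{assoc}=\mathtt{arr}\,\mathtt{assoc}>\!\!>\!\!>\mathtt{first}\,f$; where $\mathtt{fst}:X\times Z\to X$ is the first projection and $\mathtt{assoc}:(X\times Y)\times Z\to X\times(Y\times Z)$ is the canonical associativity isomorphism of $C$. -}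

module Defs where

open import Level using (Level; _⊔_) renaming (suc to lsuc)
open import Data.Product using (Σ-syntax; ∃-syntax; _×_; _,_; proj₁; proj₂)
open import Relation.Binary.Core using (Rel)
open import Relation.Binary.Structures using (IsEquivalence)

-- Hom-sets are setoids throughout: `_≈_` plays the role of equality of
-- parallel morphisms.

record Category (o ℓ e : Level) : Set (lsuc (o ⊔ ℓ ⊔ e)) where
  infix  4 _≈_
  infixr 9 _∘_
  field
    Obj : Set o
    Hom : Obj → Obj → Set ℓ
    _≈_ : ∀ {X Y} → Rel (Hom X Y) e
    id  : ∀ {X} → Hom X X
    _∘_ : ∀ {X Y Z} → Hom Y Z → Hom X Y → Hom X Z

    isEquivalence : ∀ {X Y} → IsEquivalence (_≈_ {X} {Y})
    ∘-cong : ∀ {X Y Z} {g g′ : Hom Y Z} {f f′ : Hom X Y} →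
             g ≈ g′ → f ≈ f′ → g ∘ f ≈ g′ ∘ f′
    assoc  : ∀ {W X Y Z} (h : Hom Y Z) (g : Hom X Y) (f : Hom W X) →
             (h ∘ g) ∘ f ≈ h ∘ (g ∘ f)
    identityˡ : ∀ {X Y} (f : Hom X Y) → id ∘ f ≈ f
    identityʳ : ∀ {X Y} (f : Hom X Y) → f ∘ id ≈ f

record Terminal {o ℓ e} (C : Category o ℓ e) : Set (o ⊔ ℓ ⊔ e) where
  open Category C
  field
    𝟙   : Obj
    !   : ∀ {X} → Hom X 𝟙
    !-unique : ∀ {X} (f : Hom X 𝟙) → f ≈ !

record BinaryProducts {o ℓ e} (C : Category o ℓ e) : Set (o ⊔ ℓ ⊔ e) where
  open Category C
  infixr 7 _⊗_
  infixr 8 _⊗₁_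
  field
    _⊗_   : Obj → Obj → Obj
    π₁    : ∀ {X Y} → Hom (X ⊗ Y) X
    π₂    : ∀ {X Y} → Hom (X ⊗ Y) Y
    ⟨_,_⟩ : ∀ {W X Y} → Hom W X → Hom W Y → Hom W (X ⊗ Y)
    project₁ : ∀ {W X Y} (f : Hom W X) (g : Hom W Y) → π₁ ∘ ⟨ f , g ⟩ ≈ f
    project₂ : ∀ {W X Y} (f : Hom W X) (g : Hom W Y) → π₂ ∘ ⟨ f , g ⟩ ≈ g
    unique   : ∀ {W X Y} {f : Hom W X} {g : Hom W Y} (h : Hom W (X ⊗ Y)) →
               π₁ ∘ h ≈ f → π₂ ∘ h ≈ g → h ≈ ⟨ f , g ⟩

  _⊗₁_ : ∀ {X₁ X₂ Y₁ Y₂} → Hom X₁ Y₁ → Hom X₂ Y₂ → Hom (X₁ ⊗ X₂) (Y₁ ⊗ Y₂)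
  f ⊗₁ g = ⟨ f ∘ π₁ , g ∘ π₂ ⟩

  ⊗-assoc : ∀ {X Y Z} → Hom ((X ⊗ Y) ⊗ Z) (X ⊗ (Y ⊗ Z))
  ⊗-assoc = ⟨ π₁ ∘ π₁ , ⟨ π₂ ∘ π₁ , π₂ ⟩ ⟩

record CartesianCategory (o ℓ e : Level) : Set (lsuc (o ⊔ ℓ ⊔ e)) where
  field
    category : Category o ℓ e
    terminal : Terminal category
    products : BinaryProducts category

  open Category category public
  open Terminal terminal public
  open BinaryProducts products public

record WideSubcategory {o ℓ e} (K : Category o ℓ e) (p : Level) :
       Set (o ⊔ ℓ ⊔ e ⊔ lsuc p) where
  open Category K
  field
    Pure      : ∀ {X Y} → Hom X Y → Set p
    Pure-resp : ∀ {X Y} {f f′ : Hom X Y} → f ≈ f′ → Pure f → Pure f′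
    Pure-id   : ∀ {X} → Pure (id {X})
    Pure-∘    : ∀ {X Y Z} {g : Hom Y Z} {f : Hom X Y} →
                Pure g → Pure f → Pure (g ∘ f)

  -- Proofs of purity are irrelevant to equality: two morphisms of the
  -- subcategory are equal as soon as they are equal in K.
  category : Category o (ℓ ⊔ p) e
  category = record
    { Obj = Obj
    ; Hom = λ X Y → Σ[ f ∈ Hom X Y ] Pure f
    ; _≈_ = λ v w → proj₁ v ≈ proj₁ w
    ; id  = id , Pure-id
    ; _∘_ = λ w v → proj₁ w ∘ proj₁ v , Pure-∘ (proj₂ w) (proj₂ v)
    ; isEquivalence = record
      { refl  = IsEquivalence.refl isEquivalence
      ; sym   = IsEquivalence.sym isEquivalence
      ; trans = IsEquivalence.trans isEquivalence
      }
    ; ∘-cong    = ∘-cong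
    ; assoc     = λ h g f → assoc (proj₁ h) (proj₁ g) (proj₁ f)
    ; identityˡ = λ f → identityˡ (proj₁ f)
    ; identityʳ = λ f → identityʳ (proj₁ f)
    }

  incl : ∀ {X Y} → Category.Hom category X Y → Hom X Y
  incl = proj₁

record EffectCategory (o ℓ e p c : Level) : Set (lsuc (o ⊔ ℓ ⊔ e ⊔ p ⊔ c)) where
  field
    K   : Category o ℓ e
    sub : WideSubcategory K p

  open WideSubcategory sub public using (incl) renaming (category to C)

  module K = Category K
  module C = Category C

  field
    terminal : Terminal C

  open Terminal terminal public

  𝓔 : ∀ {X Y} → K.Hom X Y → K.Hom X 𝟙
  𝓔 f = incl ! K.∘ f

  infix 4 _≋_ _◁_ _◁▷_

  _≋_ : ∀ {X Y Y′} → K.Hom X Y → K.Hom X Y′ → Set e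
  f ≋ f′ = 𝓔 f K.≈ 𝓔 f′

  field
    _◁_    : ∀ {X Y} → K.Hom X Y → C.Hom X Y → Set c
    ◁-resp : ∀ {X Y} {f f′ : K.Hom X Y} {v v′ : C.Hom X Y} →
             f K.≈ f′ → v C.≈ v′ → f ◁ v → f′ ◁ v′
    ◁-refl : ∀ {X Y} (v : C.Hom X Y) → incl v ◁ v
    ◁-comp : ∀ {X Y Y′ Z} (f : K.Hom X Y) (g : K.Hom Y Z)
             (u : C.Hom Y Y′) (v : C.Hom X Y′) (w : C.Hom Y′ Z) →
             incl u K.∘ f ◁ v → g ◁ w C.∘ u → g K.∘ f ◁ w C.∘ v

  _◁▷_ : ∀ {X Y} → K.Hom X Y → K.Hom X Y → Set (ℓ ⊔ p ⊔ c)
  f ◁▷ f′ = ∃[ v ] (f ◁ v × f′ ◁ v)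

  field
    complementarity : ∀ {X Y} (f f′ : K.Hom X Y) → f ≋ f′ → f ◁▷ f′ → f K.≈ f′

record CartesianEffectCategory (o ℓ e p c : Level) :
       Set (lsuc (o ⊔ ℓ ⊔ e ⊔ p ⊔ c)) where
  field
    effectCategory : EffectCategory o ℓ e p c

  open EffectCategory effectCategory public

  field
    products : BinaryProducts C

  cartesian : CartesianCategory o (ℓ ⊔ p) e
  cartesian = record
    { category = C
    ; terminal = terminal
    ; products = products
    }

  open BinaryProducts products public

  infixr 8 _⋉_ _⋊_

  -- That `_⋉_` and `_⋊_` respect equality of morphisms is not assumed: it
  -- follows from `⋉-unique` and `⋊-unique`.
  field
    _⋉_ : ∀ {X₁ X₂ Y₁ Y₂} →
          C.Hom X₁ Y₁ → K.Hom X₂ Y₂ → K.Hom (X₁ ⊗ X₂) (Y₁ ⊗ Y₂)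
    _⋊_ : ∀ {X₁ X₂ Y₁ Y₂} →
          K.Hom X₁ Y₁ → C.Hom X₂ Y₂ → K.Hom (X₁ ⊗ X₂) (Y₁ ⊗ Y₂)

    ⋉-extends : ∀ {X₁ X₂ Y₁ Y₂} (v₁ : C.Hom X₁ Y₁) (v₂ : C.Hom X₂ Y₂) →
                v₁ ⋉ incl v₂ K.≈ incl (v₁ ⊗₁ v₂)
    ⋊-extends : ∀ {X₁ X₂ Y₁ Y₂} (v₁ : C.Hom X₁ Y₁) (v₂ : C.Hom X₂ Y₂) →
                incl v₁ ⋊ v₂ K.≈ incl (v₁ ⊗₁ v₂)

    ⋉-proj₁  : ∀ {X₁ X₂ Y₁ Y₂} (v₁ : C.Hom X₁ Y₁) (f₂ : K.Hom X₂ Y₂) →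
               incl π₁ K.∘ (v₁ ⋉ f₂) ◁ v₁ C.∘ π₁
    ⋉-proj₂  : ∀ {X₁ X₂ Y₁ Y₂} (v₁ : C.Hom X₁ Y₁) (f₂ : K.Hom X₂ Y₂) →
               incl π₂ K.∘ (v₁ ⋉ f₂) K.≈ f₂ K.∘ incl π₂
    ⋉-unique : ∀ {X₁ X₂ Y₁ Y₂} (v₁ : C.Hom X₁ Y₁) (f₂ : K.Hom X₂ Y₂)
               (h : K.Hom (X₁ ⊗ X₂) (Y₁ ⊗ Y₂)) →
               incl π₁ K.∘ h ◁ v₁ C.∘ π₁ →
               incl π₂ K.∘ h K.≈ f₂ K.∘ incl π₂ →
               h K.≈ v₁ ⋉ f₂

    ⋊-proj₁  : ∀ {X₁ X₂ Y₁ Y₂} (f₁ : K.Hom X₁ Y₁) (v₂ : C.Hom X₂ Y₂) →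
               incl π₁ K.∘ (f₁ ⋊ v₂) K.≈ f₁ K.∘ incl π₁
    ⋊-proj₂  : ∀ {X₁ X₂ Y₁ Y₂} (f₁ : K.Hom X₁ Y₁) (v₂ : C.Hom X₂ Y₂) →
               incl π₂ K.∘ (f₁ ⋊ v₂) ◁ v₂ C.∘ π₂
    ⋊-unique : ∀ {X₁ X₂ Y₁ Y₂} (f₁ : K.Hom X₁ Y₁) (v₂ : C.Hom X₂ Y₂)
               (h : K.Hom (X₁ ⊗ X₂) (Y₁ ⊗ Y₂)) →
               incl π₁ K.∘ h K.≈ f₁ K.∘ incl π₁ →
               incl π₂ K.∘ h ◁ v₂ C.∘ π₂ →
               h K.≈ f₁ ⋊ v₂

record RawArrow {o ℓ e} (C : CartesianCategory o ℓ e) (a r : Level) :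
       Set (o ⊔ ℓ ⊔ lsuc (a ⊔ r)) where
  private module C = CartesianCategory C
  open C using (Obj; _⊗_)
  infix  4 _≈_
  infixl 5 _>>>_
  field
    A     : Obj → Obj → Set a
    _≈_   : ∀ {X Y} → Rel (A X Y) r
    arr   : ∀ {X Y} → C.Hom X Y → A X Y
    _>>>_ : ∀ {X Y Z} → A X Y → A Y Z → A X Z
    first : ∀ {X Y Z} → A X Y → A (X ⊗ Z) (Y ⊗ Z)

record IsArrow {o ℓ e a r} (C : CartesianCategory o ℓ e) (R : RawArrow C a r) :
       Set (o ⊔ ℓ ⊔ e ⊔ a ⊔ r) where
  private module C = CartesianCategory C
  open C using (_⊗_; _⊗₁_; π₁; ⊗-assoc)
  open RawArrow R
  field
    isEquivalence : ∀ {X Y} → IsEquivalence (_≈_ {X} {Y})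
    arr-cong   : ∀ {X Y} {v v′ : C.Hom X Y} → v C.≈ v′ → arr v ≈ arr v′
    >>>-cong   : ∀ {X Y Z} {f f′ : A X Y} {g g′ : A Y Z} →
                 f ≈ f′ → g ≈ g′ → f >>> g ≈ f′ >>> g′
    first-cong : ∀ {X Y Z} {f f′ : A X Y} →
                 f ≈ f′ → first {Z = Z} f ≈ first f′

    identityˡ : ∀ {X Y} (f : A X Y) → arr C.id >>> f ≈ f
    identityʳ : ∀ {X Y} (f : A X Y) → f >>> arr C.id ≈ f
    assoc     : ∀ {W X Y Z} (f : A W X) (g : A X Y) (h : A Y Z) →
                (f >>> g) >>> h ≈ f >>> (g >>> h)
    arr-∘     : ∀ {X Y Z} (v : C.Hom X Y) (w : C.Hom Y Z) →
                arr (w C.∘ v) ≈ arr v >>> arr w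
    first-arr : ∀ {X Y Z} (v : C.Hom X Y) →
                first {Z = Z} (arr v) ≈ arr (v ⊗₁ C.id)
    first->>> : ∀ {X Y Z W} (f : A X Y) (g : A Y Z) →
                first {Z = W} (f >>> g) ≈ first f >>> first g
    first-exchange : ∀ {X Y Z W} (f : A X Y) (v : C.Hom Z W) →
                     first f >>> arr (C.id ⊗₁ v) ≈ arr (C.id ⊗₁ v) >>> first f
    first-fst   : ∀ {X Y Z} (f : A X Y) →
                  first {Z = Z} f >>> arr π₁ ≈ arr π₁ >>> f
    first-assoc : ∀ {X Y Z W} (f : A X Y) →
                  first {Z = W} (first {Z = Z} f) >>> arr ⊗-assoc
                    ≈ arr ⊗-assoc >>> first f

effectArrow : ∀ {o ℓ e p c} (E : CartesianEffectCategory o ℓ e p c) →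
              RawArrow (CartesianEffectCategory.cartesian E) ℓ e
effectArrow E = record
  { A     = K.Hom
  ; _≈_   = K._≈_
  ; arr   = incl
  ; _>>>_ = λ f g → g K.∘ f
  ; first = λ f → f ⋊ C.id
  }
  where open CartesianEffectCategory E

{-# OPTIONS --safe #-}
module Submission where

-- The laws without `first` are those of the category K.  The values of `first` on
-- pure morphisms and the law for the first projection are part of the
-- description of `⋊`.  The remaining laws rest on the functoriality of `⋊`,
--
--     (g ⋊ w) ∘ (f ⋊ v) ≈ (g ∘ f) ⋊ (w ∘ v)        (`⋊-∘`),
--
-- which follows from the uniqueness of semi-pure products: the first
-- projections agree strictly, and the second projection of the composite is
-- consistent with w ∘ v ∘ π₂ by the composition axiom of `◁`, used with the
-- projection π₂ as mediating pure morphism.  Since `⋊` extends `×`, the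
-- exchange law is a special case.
--
-- For `first-assoc`, let α be the associativity isomorphism and F = f ⋊ id on
-- X × (Z × W).  Checking directly that α ∘ ((f ⋊ id) ⋊ id) ∘ α⁻¹ satisfies
-- the characterization of F would require a consistency between morphisms
-- into the product Z × W, which consistency of the components does not
-- obviously give.  The conjugate in the other direction avoids this:
-- α⁻¹ ∘ F ∘ α satisfies the characterization of (f ⋊ id) ⋊ id, because its
-- first projection is computed by the exchange law, and its second one is a
-- composite of the second projection of F with pure morphisms
-- (`⋊-assoc-conjugate`).

open import Level using (Level)
open import Defs
open import Relation.Binary.Bundles using (Setoid)
open import Relation.Binary.Structures using (IsEquivalence)
import Relation.Binary.Reasoning.Setoid as SetoidReasoning

module CategoryProperties {o ℓ e} (C : Category o ℓ e) where
  open Category C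

  hom-setoid : ∀ X Y → Setoid ℓ e
  hom-setoid X Y = record
    { Carrier = Hom X Y ; _≈_ = _≈_ ; isEquivalence = isEquivalence }

  module Equiv {X Y} = IsEquivalence (isEquivalence {X} {Y})
  module HomReasoning {X Y} = SetoidReasoning (hom-setoid X Y)

  open Equiv

  ∘-congˡ : ∀ {X Y Z} {g : Hom Y Z} {f f′ : Hom X Y} →
            f ≈ f′ → g ∘ f ≈ g ∘ f′
  ∘-congˡ = ∘-cong refl

  ∘-congʳ : ∀ {X Y Z} {g g′ : Hom Y Z} {f : Hom X Y} →
            g ≈ g′ → g ∘ f ≈ g′ ∘ f
  ∘-congʳ eq = ∘-cong eq refl

  pullˡ : ∀ {W X Y Z} {h : Hom Y Z} {g : Hom X Y} {k : Hom X Z}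
          {f : Hom W X} → h ∘ g ≈ k → h ∘ (g ∘ f) ≈ k ∘ f
  pullˡ eq = trans (sym (assoc _ _ _)) (∘-congʳ eq)

  pullʳ : ∀ {W X Y Z} {h : Hom Y Z} {g : Hom X Y} {f : Hom W X}
          {k : Hom W Y} → g ∘ f ≈ k → (h ∘ g) ∘ f ≈ h ∘ k
  pullʳ eq = trans (assoc _ _ _) (∘-congˡ eq)

module ProductProperties {o ℓ e} {C : Category o ℓ e}
                         (P : BinaryProducts C) where
  open Category C
  open BinaryProducts P
  open CategoryProperties C
  open Equiv
  open HomReasoning

  ⊗-ext : ∀ {W X Y} {h k : Hom W (X ⊗ Y)} →
          π₁ ∘ h ≈ π₁ ∘ k → π₂ ∘ h ≈ π₂ ∘ k → h ≈ k
  ⊗-ext eq₁ eq₂ = trans (unique _ eq₁ eq₂) (sym (unique _ refl refl))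

  -- The inverse of `⊗-assoc`.  Its first component is written as the product
  -- morphism id × π₁, the form to which the exchange law applies.
  ⊗-assoc⁻¹ : ∀ {X Y Z} → Hom (X ⊗ (Y ⊗ Z)) ((X ⊗ Y) ⊗ Z)
  ⊗-assoc⁻¹ = ⟨ id ⊗₁ π₁ , π₂ ∘ π₂ ⟩

  id⊗π₁∘⊗-assoc : ∀ {X Y Z} →
                  (id ⊗₁ π₁) ∘ ⊗-assoc {X} {Y} {Z} ≈ π₁
  id⊗π₁∘⊗-assoc = ⊗-ext
    (begin
      π₁ ∘ ((id ⊗₁ π₁) ∘ ⊗-assoc)  ≈⟨ pullˡ (project₁ _ _) ⟩
      (id ∘ π₁) ∘ ⊗-assoc          ≈⟨ ∘-congʳ (identityˡ _) ⟩
      π₁ ∘ ⊗-assoc                 ≈⟨ project₁ _ _ ⟩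
      π₁ ∘ π₁                      ∎)
    (begin
      π₂ ∘ ((id ⊗₁ π₁) ∘ ⊗-assoc)  ≈⟨ pullˡ (project₂ _ _) ⟩
      (π₁ ∘ π₂) ∘ ⊗-assoc          ≈⟨ pullʳ (project₂ _ _) ⟩
      π₁ ∘ ⟨ π₂ ∘ π₁ , π₂ ⟩        ≈⟨ project₁ _ _ ⟩
      π₂ ∘ π₁                      ∎)

  π₂∘π₂∘⊗-assoc : ∀ {X Y Z} → π₂ ∘ (π₂ ∘ ⊗-assoc {X} {Y} {Z}) ≈ π₂
  π₂∘π₂∘⊗-assoc = trans (∘-congˡ (project₂ _ _)) (project₂ _ _)

  ⊗-assoc-inverseʳ : ∀ {X Y Z} → ⊗-assoc {X} {Y} {Z} ∘ ⊗-assoc⁻¹ ≈ id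
  ⊗-assoc-inverseʳ = ⊗-ext
    (begin
      π₁ ∘ (⊗-assoc ∘ ⊗-assoc⁻¹)  ≈⟨ pullˡ (project₁ _ _) ⟩
      (π₁ ∘ π₁) ∘ ⊗-assoc⁻¹       ≈⟨ pullʳ (project₁ _ _) ⟩
      π₁ ∘ (id ⊗₁ π₁)             ≈⟨ project₁ _ _ ⟩
      id ∘ π₁                     ≈⟨ identityˡ _ ⟩
      π₁                          ≈⟨ identityʳ _ ⟨
      π₁ ∘ id                     ∎)
    (begin
      π₂ ∘ (⊗-assoc ∘ ⊗-assoc⁻¹)         ≈⟨ pullˡ (project₂ _ _) ⟩
      ⟨ π₂ ∘ π₁ , π₂ ⟩ ∘ ⊗-assoc⁻¹       ≈⟨ ⊗-ext fst-eq snd-eq ⟩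
      π₂                                 ≈⟨ identityʳ _ ⟨
      π₂ ∘ id                            ∎)
    where
    fst-eq : ∀ {X Y Z} →
             π₁ ∘ (⟨ π₂ ∘ π₁ , π₂ ⟩ ∘ ⊗-assoc⁻¹ {X} {Y} {Z}) ≈ π₁ ∘ π₂
    fst-eq = begin
      π₁ ∘ (⟨ π₂ ∘ π₁ , π₂ ⟩ ∘ ⊗-assoc⁻¹)  ≈⟨ pullˡ (project₁ _ _) ⟩
      (π₂ ∘ π₁) ∘ ⊗-assoc⁻¹                ≈⟨ pullʳ (project₁ _ _) ⟩
      π₂ ∘ (id ⊗₁ π₁)                      ≈⟨ project₂ _ _ ⟩
      π₁ ∘ π₂                              ∎

    snd-eq : ∀ {X Y Z} →
             π₂ ∘ (⟨ π₂ ∘ π₁ , π₂ ⟩ ∘ ⊗-assoc⁻¹ {X} {Y} {Z}) ≈ π₂ ∘ π₂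
    snd-eq = trans (pullˡ (project₂ _ _)) (project₂ _ _)

module SemiPureProperties {o ℓ e p c}
                          (E : CartesianEffectCategory o ℓ e p c) where
  open CartesianEffectCategory E
  open CategoryProperties K
  open ProductProperties products
  open Equiv
  open HomReasoning

  ◁-∘ : ∀ {X Y Z} {f : K.Hom X Y} {g : K.Hom Y Z}
        {v : C.Hom X Y} {w : C.Hom Y Z} →
        f ◁ v → g ◁ w → g K.∘ f ◁ w C.∘ v
  ◁-∘ {f = f} {g} {v} {w} f◁v g◁w = ◁-comp f g C.id v w
    (◁-resp {v = v} {v} (sym (K.identityˡ f)) refl f◁v)
    (◁-resp {v = w} {w C.∘ C.id} refl (sym (K.identityʳ _)) g◁w)

  ⋊-cong : ∀ {X₁ X₂ Y₁ Y₂} {f f′ : K.Hom X₁ Y₁} {v v′ : C.Hom X₂ Y₂} →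
           f K.≈ f′ → v C.≈ v′ → f ⋊ v K.≈ f′ ⋊ v′
  ⋊-cong {f = f} {f′} {v} {v′} f≈f′ v≈v′ = ⋊-unique f′ v′ (f ⋊ v)
    (trans (⋊-proj₁ f v) (∘-congʳ f≈f′))
    (◁-resp {v = v C.∘ π₂} {v′ C.∘ π₂} refl (∘-congʳ v≈v′) (⋊-proj₂ f v))

  ⋊-∘ : ∀ {X₁ X₂ Y₁ Y₂ Z₁ Z₂}
        (g : K.Hom Y₁ Z₁) (w : C.Hom Y₂ Z₂)
        (f : K.Hom X₁ Y₁) (v : C.Hom X₂ Y₂) →
        (g ⋊ w) K.∘ (f ⋊ v) K.≈ (g K.∘ f) ⋊ (w C.∘ v)
  ⋊-∘ g w f v = ⋊-unique (g K.∘ f) (w C.∘ v) ((g ⋊ w) K.∘ (f ⋊ v))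
    (begin
      incl π₁ K.∘ ((g ⋊ w) K.∘ (f ⋊ v))  ≈⟨ pullˡ (⋊-proj₁ g w) ⟩
      (g K.∘ incl π₁) K.∘ (f ⋊ v)        ≈⟨ pullʳ (⋊-proj₁ f v) ⟩
      g K.∘ (f K.∘ incl π₁)              ≈⟨ K.assoc _ _ _ ⟨
      (g K.∘ f) K.∘ incl π₁              ∎)
    (◁-resp {v = w C.∘ (v C.∘ π₂)} {(w C.∘ v) C.∘ π₂}
      (K.assoc _ _ _) (sym (K.assoc _ _ _))
      -- f ⋊ v is known to be consistent with a pure morphism only after
      -- projection by π₂, so π₂ is the mediating morphism; `◁-∘`, where it is
      -- the identity, does not apply.
      (◁-comp (f ⋊ v) (incl π₂ K.∘ (g ⋊ w)) π₂ (v C.∘ π₂) w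
        (⋊-proj₂ f v) (⋊-proj₂ g w)))

  ⋊-exchange : ∀ {X Y Z W} (f : K.Hom X Y) (v : C.Hom Z W) →
               incl (C.id ⊗₁ v) K.∘ (f ⋊ C.id) K.≈
               (f ⋊ C.id) K.∘ incl (C.id ⊗₁ v)
  ⋊-exchange f v = begin
    incl (C.id ⊗₁ v) K.∘ (f ⋊ C.id)    ≈⟨ ∘-congʳ (⋊-extends C.id v) ⟨
    (K.id ⋊ v) K.∘ (f ⋊ C.id)          ≈⟨ ⋊-∘ K.id v f C.id ⟩
    (K.id K.∘ f) ⋊ (v C.∘ C.id)        ≈⟨ ⋊-cong f-eq v-eq ⟩
    (f K.∘ K.id) ⋊ (C.id C.∘ v)        ≈⟨ ⋊-∘ f C.id K.id v ⟨
    (f ⋊ C.id) K.∘ (K.id ⋊ v)          ≈⟨ ∘-congˡ (⋊-extends C.id v) ⟩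
    (f ⋊ C.id) K.∘ incl (C.id ⊗₁ v)    ∎
    where
    f-eq : K.id K.∘ f K.≈ f K.∘ K.id
    f-eq = trans (K.identityˡ f) (sym (K.identityʳ f))

    v-eq : v C.∘ C.id C.≈ C.id C.∘ v
    v-eq = trans (K.identityʳ _) (sym (K.identityˡ _))

  ⋊-assoc-conjugate : ∀ {X Y Z W} (f : K.Hom X Y) →
    incl ⊗-assoc⁻¹ K.∘ ((f ⋊ C.id {Z ⊗ W}) K.∘ incl ⊗-assoc) K.≈
    (f ⋊ C.id) ⋊ C.id
  ⋊-assoc-conjugate {X} {Y} {Z} {W} f =
    ⋊-unique (f ⋊ C.id) C.id t fst-eq snd-consistent
    where
    α : C.Hom ((X ⊗ Z) ⊗ W) (X ⊗ (Z ⊗ W))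
    α = ⊗-assoc

    F : K.Hom (X ⊗ (Z ⊗ W)) (Y ⊗ (Z ⊗ W))
    F = f ⋊ C.id

    t : K.Hom ((X ⊗ Z) ⊗ W) ((Y ⊗ Z) ⊗ W)
    t = incl ⊗-assoc⁻¹ K.∘ (F K.∘ incl α)

    fst-eq : incl π₁ K.∘ t K.≈ (f ⋊ C.id) K.∘ incl π₁
    fst-eq = begin
      incl π₁ K.∘ t
        ≈⟨ pullˡ (project₁ _ (π₂ C.∘ π₂)) ⟩
      incl (C.id ⊗₁ π₁) K.∘ (F K.∘ incl α)
        ≈⟨ pullˡ (⋊-exchange f π₁) ⟩
      ((f ⋊ C.id) K.∘ incl (C.id ⊗₁ π₁)) K.∘ incl α
        ≈⟨ pullʳ id⊗π₁∘⊗-assoc ⟩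
      (f ⋊ C.id) K.∘ incl π₁ ∎

    snd-eq : incl π₂ K.∘ t K.≈ incl π₂ K.∘ ((incl π₂ K.∘ F) K.∘ incl α)
    snd-eq = begin
      incl π₂ K.∘ t
        ≈⟨ pullˡ (project₂ (C.id ⊗₁ π₁) _) ⟩
      (incl π₂ K.∘ incl π₂) K.∘ (F K.∘ incl α)
        ≈⟨ pullʳ (sym (K.assoc _ _ _)) ⟩
      incl π₂ K.∘ ((incl π₂ K.∘ F) K.∘ incl α) ∎

    target-eq : π₂ C.∘ ((C.id C.∘ π₂) C.∘ α) C.≈ C.id C.∘ π₂
    target-eq = begin
      incl π₂ K.∘ ((K.id K.∘ incl π₂) K.∘ incl α)
        ≈⟨ ∘-congˡ (∘-congʳ (K.identityˡ _)) ⟩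
      incl π₂ K.∘ (incl π₂ K.∘ incl α)
        ≈⟨ π₂∘π₂∘⊗-assoc ⟩
      incl π₂
        ≈⟨ K.identityˡ _ ⟨
      K.id K.∘ incl π₂ ∎

    snd-consistent : incl π₂ K.∘ t ◁ C.id C.∘ π₂
    snd-consistent =
      ◁-resp {v = π₂ C.∘ ((C.id C.∘ π₂) C.∘ α)} {C.id C.∘ π₂}
        (sym snd-eq) target-eq
        (◁-∘ (◁-∘ (◁-refl α) (⋊-proj₂ f C.id)) (◁-refl π₂))

  ⋊-assoc : ∀ {X Y Z W} (f : K.Hom X Y) →
            incl ⊗-assoc K.∘ ((f ⋊ C.id {Z}) ⋊ C.id {W}) K.≈
            (f ⋊ C.id) K.∘ incl ⊗-assoc
  ⋊-assoc f = begin
    incl ⊗-assoc K.∘ ((f ⋊ C.id) ⋊ C.id)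
      ≈⟨ ∘-congˡ (⋊-assoc-conjugate f) ⟨
    incl ⊗-assoc K.∘ (incl ⊗-assoc⁻¹ K.∘ ((f ⋊ C.id) K.∘ incl ⊗-assoc))
      ≈⟨ pullˡ ⊗-assoc-inverseʳ ⟩
    K.id K.∘ ((f ⋊ C.id) K.∘ incl ⊗-assoc)
      ≈⟨ K.identityˡ _ ⟩
    (f ⋊ C.id) K.∘ incl ⊗-assoc ∎

proposition17 : ∀ {o ℓ e p c : Level} (E : CartesianEffectCategory o ℓ e p c) →
    IsArrow (CartesianEffectCategory.cartesian E) (effectArrow E)
proposition17 E = record
  { isEquivalence  = K.isEquivalence
  ; arr-cong       = λ v≈v′ → v≈v′
  ; >>>-cong       = λ f≈f′ g≈g′ → K.∘-cong g≈g′ f≈f′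
  ; first-cong     = λ f≈f′ → ⋊-cong f≈f′ refl
  ; identityˡ      = K.identityʳ
  ; identityʳ      = K.identityˡ
  ; assoc          = λ f g h → sym (K.assoc h g f)
  ; arr-∘          = λ v w → refl
  ; first-arr      = λ v → ⋊-extends v C.id
  ; first->>>      = λ f g →
      trans (⋊-cong refl (sym (K.identityˡ K.id))) (sym (⋊-∘ g C.id f C.id))
  ; first-exchange = ⋊-exchange
  ; first-fst      = λ f → ⋊-proj₁ f C.id
  ; first-assoc    = ⋊-assoc
  }
  where
  open CartesianEffectCategory E
  open SemiPureProperties E
  open CategoryProperties.Equiv K
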